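{- Let $m,n$ be non-negative integers. For a fixed partition $\lambda$ of length at most $m+n$, there is a 1-to-1 correspondence between $\mathfrak{P}(n,m)$ and the set $\{(\mu,\nu):\mu\star_{m,n}\nu=\lambda\}$ of all pairs of partitions (of length at most $m$ and $n$, respectively) whose $(m,n)$-overlap is $\lambda$, given by $$\pi\mapsto\left(\mu(\pi)+\lambda_{V(\pi)},\ \nu(\pi)'+\lambda_{H(\pi)}\right).$$ Moreover, $\varepsilon_{m,n}\left(\mu(\pi)+\lambda_{V(\pi)},\,\nu(\pi)'+\lambda_{H(\pi)}\right)=(-1)^{|\nu(\pi)|}=(-1)^{mn-|\mu(\pi)|}$.
   Context: A partition is a non-increasing sequence of non-negative integers; partitions differing only by trailing zeros are equal; its length is the number of positive parts, its size $|\lambda|$ is the sum of its parts, and $\lambda'$ is its conjugate. When used as a sequence of prescribed length, a partition is padded with zeros. Sums of sequences are elementwise, and the union $\mathcal{A}\cup\mathcal{B}$ of two sequences is obtained by appending $\mathcal{B}$ to $\mathcal{A}$. For a subsequence $K$ of $[N]=(1,\dots,N)$ and a sequence $\lambda$ of length $N$, $\lambda_K=(\lambda_{K_1},\dots,\lambda_{K_{l(K)}})$. $\langle n^m\rangle=(n,\dots,n)$ ($m$ entries); $\mu\subset\langle n^m\rangle$ denotes containment of Ferrers diagrams. Staircase walks: $\mathfrak{P}(n,m)$ is the set of all lattice walks using only unit west and south steps from the top-right to the bottom-left corner of a rectangle of width $n$ and height $m$. For $\pi\in\mathfrak{P}(n,m)$, $\mu(\pi)\subset\langle n^m\rangle$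 is the partition whose Ferrers diagram (rows left-justified, from top to bottom) consists of the boxes above $\pi$, and $\nu(\pi)\subset\langle n^m\rangle$ is the partition whose Ferrers diagram, rotated by 180 degrees, consists of the boxes below $\pi$ (so $\nu(\pi)_i=n-\mu(\pi)_{m+1-i}$ for $1\le i\le m$). $V(\pi)$ and $H(\pi)$ are the increasing sequences of the times (positions in $1,\dots,m+n$) of the vertical and horizontal steps of $\pi$, respectively. Overlap: $\rho_n=(n-1,\dots,1,0)$ ($\rho_0$ is empty). For partitions $\mu,\nu$ of length at most $m$ and $n$, respectively, the $(m,n)$-overlap $\mu\star_{m,n}\nu$ is the partition (of length at most $m+n$) such that $\mu\star_{m,n}\nu+\rho_{m+n}$ equals $(\mu+\rho_m)\cup(\nu+\rho_n)$ up to reordering, if it exists; otherwise $\mu\star_{m,n}\nu=\infty$, a symbol that is not a partition. If the overlap is a partition, $\varepsilon_{m,n}(\mu,\nu)$ is the sign of the permutation sorting $(\mu+\rho_m)\cup(\nu+\rho_n)$ into the strictly decreasing sequence $\mu\star_{m,n}\nu+\rho_{m+n}$; otherwise $\varepsilon_{m,n}(\mu,\nu)=1$. -}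

module Defs where

open import Data.Fin.Base as Fin using (Fin; zero; suc; toℕ; opposite)
import Data.Fin.Properties as Fin
open import Data.Fin.Permutation as Perm using (Permutation′; _⟨$⟩ʳ_; _⟨$⟩ˡ_; _∘ₚ_)
open import Data.Integer.Base as ℤ using (ℤ; -1ℤ; 1ℤ)
open import Data.Maybe.Base using (Maybe; just; nothing)
open import Data.Nat.Base
open import Data.Nat.Properties
open import Data.Product.Base using (Σ-syntax; ∃-syntax; _×_; _,_; proj₁; proj₂)
open import Data.Vec.Base as Vec
  using (Vec; []; _∷_; _++_; zipWith; lookup; tabulate; count; allFin)
open import Data.Vec.Properties using (lookup∘tabulate)
open import Data.Vec.Functional.Relation.Binary.Permutation using (_↭_)
open import Data.Vec.Relation.Unary.All as All using (All; []; _∷_)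
import Data.Vec.Relation.Unary.All.Properties as All
open import Data.Vec.Relation.Unary.Linked as Linked using (Linked; []; [-]; _∷_)
import Data.Vec.Relation.Unary.Linked.Properties as Linked
open import Function.Base using (flip)
open import Relation.Binary.Definitions using (tri<; tri≈; tri>)
open import Relation.Binary.PropositionalEquality
open import Relation.Nullary.Decidable using (Dec; yes; no; _×-dec_)
open import Relation.Nullary.Negation using (contradiction)
open import Relation.Unary using (Pred; Decidable; _⊆_)

-- A partition of length at most n, represented by its unique
-- zero-padded sequence with exactly n entries.

record Partition (n : ℕ) : Set where
  constructor partition
  field
    parts         : Vec ℕ n
    nonincreasing : Linked _≥_ parts

open Partition public

Partition-≡ : ∀ {n} {α β : Partition n} → parts α ≡ parts β → α ≡ β
Partition-≡ {α = partition as p} {partition .as q} refl =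
  cong (partition as) (Linked.irrelevant ≤-irrelevant p q)

∣_∣ : ∀ {n} → Partition n → ℕ
∣ α ∣ = Vec.sum (parts α)

infixl 6 _⊕_

_⊕_ : ∀ {n} → Partition n → Partition n → Partition n
α ⊕ β = partition (zipWith _+_ (parts α) (parts β))
                  (go (nonincreasing α) (nonincreasing β))
  where
  go : ∀ {n} {as bs : Vec ℕ n} → Linked _≥_ as → Linked _≥_ bs →
       Linked _≥_ (zipWith _+_ as bs)
  go []  []  = []
  go [-] [-] = [-]
  go {as = _ ∷ _ ∷ _} {_ ∷ _ ∷ _} (a ∷ as) (b ∷ bs) = +-mono-≤ a b ∷ go as bs

infix 4 _⊆⟨_⟩

-- α ⊆⟨ n ⟩, for α : Partition m, says α ⊂ ⟨nᵐ⟩.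

_⊆⟨_⟩ : ∀ {m} → Partition m → ℕ → Set
α ⊆⟨ n ⟩ = All (_≤ n) (parts α)

antitone⇒Linked : ∀ {n} (as : Vec ℕ n) →
  (∀ i j → i Fin.≤ j → lookup as j ≤ lookup as i) → Linked _≥_ as
antitone⇒Linked []           f = []
antitone⇒Linked (_ ∷ [])     f = [-]
antitone⇒Linked (_ ∷ _ ∷ as) f =
  f zero (suc zero) z≤n ∷
  antitone⇒Linked (_ ∷ as) (λ i j i≤j → f (suc i) (suc j) (s≤s i≤j))

Linked⇒antitone : ∀ {n} {as : Vec ℕ n} → Linked _≥_ as →
  ∀ {i j} → i Fin.≤ j → lookup as j ≤ lookup as i
Linked⇒antitone {as = as} l {i} {j} i≤j with i Fin.≟ j
... | yes refl = ≤-refl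
... | no i≢j   = Linked.lookup⁺ (flip ≤-trans) l (Fin.≤∧≢⇒< i≤j i≢j)

antitone-tabulate : ∀ {n} (f : Fin n → ℕ) →
  (∀ {i j} → i Fin.≤ j → f j ≤ f i) → Linked _≥_ (tabulate f)
antitone-tabulate f anti = antitone⇒Linked (tabulate f) (λ i j i≤j →
  subst₂ _≤_ (sym (lookup∘tabulate f j)) (sym (lookup∘tabulate f i)) (anti i≤j))

count-mono : ∀ {p q n} {P : Pred ℕ p} {Q : Pred ℕ q}
  (P? : Decidable P) (Q? : Decidable Q) → P ⊆ Q →
  (as : Vec ℕ n) → count P? as ≤ count Q? as
count-mono P? Q? f [] = z≤n
count-mono P? Q? f (a ∷ as) with P? a | Q? a
... | yes p | yes q = s≤s (count-mono P? Q? f as)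
... | yes p | no ¬q = contradiction (f p) ¬q
... | no ¬p | yes q = m≤n⇒m≤1+n (count-mono P? Q? f as)
... | no ¬p | no ¬q = count-mono P? Q? f as

-- The j-th column length is the number of parts that are at least j
-- (here toℕ j = j - 1).  The containment hypothesis ensures that there
-- are no columns beyond the n-th.

conjugate : ∀ {m n} (α : Partition m) → α ⊆⟨ n ⟩ → Partition n
conjugate {n = n} α _ = partition
  (tabulate {n = n} (λ j → count (toℕ j <?_) (parts α)))
  (antitone-tabulate _ (λ {i} {j} i≤j →
     count-mono (toℕ j <?_) (toℕ i <?_) (≤-<-trans i≤j) (parts α)))

-- A subsequence of length k of [N]; Fin N stands for {1,…,N}.

record Subsequence (k N : ℕ) : Set where
  constructor subsequence
  field
    indices    : Vec (Fin N) k
    increasing : Linked Fin._<_ indices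

open Subsequence public

infix 8 _↾_

_↾_ : ∀ {k N} → Partition N → Subsequence k N → Partition k
α ↾ K = partition
  (Vec.map (lookup (parts α)) (indices K))
  (Linked.map⁺ (Linked.map (Linked.lookup⁺ (flip ≤-trans) (nonincreasing α))
                           (increasing K)))

mapSubsequence : ∀ {k M N} (f : Fin M → Fin N) →
  (∀ {i j} → i Fin.< j → f i Fin.< f j) → Subsequence k M → Subsequence k N
mapSubsequence f f-mono (subsequence is incr) =
  subsequence (Vec.map f is) (Linked.map⁺ (Linked.map f-mono incr))

castTimes : ∀ {k M N} → .(M ≡ N) → Subsequence k M → Subsequence k N
castTimes eq = mapSubsequence (Fin.cast eq) (λ {i} {j} i<j →
  subst₂ _<_ (sym (Fin.toℕ-cast eq i)) (sym (Fin.toℕ-cast eq j)) i<j)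

later : ∀ {k N} → Subsequence k N → Subsequence k (suc N)
later = mapSubsequence suc s<s

now∷_ : ∀ {k N} → Subsequence k N → Subsequence (suc k) (suc N)
now∷ K = subsequence (zero ∷ indices (later K))
                     (go (indices K) (increasing (later K)))
  where
  go : ∀ {k N} (is : Vec (Fin N) k) → Linked Fin._<_ (Vec.map suc is) →
       Linked Fin._<_ (zero ∷ Vec.map suc is)
  go []       _ = [-]
  go (_ ∷ is) l = z<s ∷ l

-- Walk n m is the set 𝔓(n,m): the indices are the numbers of west and
-- south steps still to be taken before the bottom-left corner.

data Walk : ℕ → ℕ → Set where
  end   : Walk 0 0
  west  : ∀ {n m} → Walk n m → Walk (suc n) m
  south : ∀ {n m} → Walk n m → Walk n (suc m)

-- The number of boxes in each row (from top to bottom) to the left of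
-- the walk: a south step taken with n west steps still to come has
-- exactly n boxes to its left.

rowsAbove : ∀ {n m} → Walk n m → Vec ℕ m
rowsAbove end               = []
rowsAbove (west π)          = rowsAbove π
rowsAbove {n = n} (south π) = n ∷ rowsAbove π

rowsAbove-≤ : ∀ {n m} (π : Walk n m) → All (_≤ n) (rowsAbove π)
rowsAbove-≤ end       = []
rowsAbove-≤ (west π)  = All.map m≤n⇒m≤1+n (rowsAbove-≤ π)
rowsAbove-≤ (south π) = ≤-refl ∷ rowsAbove-≤ π

μ : ∀ {n m} → Walk n m → Partition m
μ π = partition (rowsAbove π) (go π)
  where
  cons : ∀ {n m} {as : Vec ℕ m} →
         All (_≤ n) as → Linked _≥_ as → Linked _≥_ (n ∷ as)
  cons []      _ = [-]
  cons (p ∷ _) l = p ∷ l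

  go : ∀ {n m} (π : Walk n m) → Linked _≥_ (rowsAbove π)
  go end       = []
  go (west π)  = go π
  go (south π) = cons (rowsAbove-≤ π) (go π)

-- ν(π)ᵢ = n - μ(π)ₘ₊₁₋ᵢ; no truncation occurs, by rowsAbove-≤.

ν : ∀ {n m} → Walk n m → Partition m
ν {n} π = partition
  (tabulate (λ i → n ∸ lookup (parts (μ π)) (opposite i)))
  (antitone-tabulate _ (λ {i} {j} i≤j →
     ∸-monoʳ-≤ n (Linked⇒antitone (nonincreasing (μ π)) (opp-anti i j i≤j))))
  where
  opp-anti : ∀ {k} (i j : Fin k) → i Fin.≤ j → opposite j Fin.≤ opposite i
  opp-anti {k} i j i≤j =
    subst₂ _≤_ (sym (Fin.opposite-prop j)) (sym (Fin.opposite-prop i))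
           (∸-monoʳ-≤ k (s≤s i≤j))

ν-⊆ : ∀ {n m} (π : Walk n m) → ν π ⊆⟨ n ⟩
ν-⊆ {n} π = All.tabulate⁺ (λ i → m∸n≤m n (lookup (parts (μ π)) (opposite i)))

ν′ : ∀ {n m} → Walk n m → Partition n
ν′ π = conjugate (ν π) (ν-⊆ π)

V : ∀ {n m} → Walk n m → Subsequence m (m + n)
V end                   = subsequence [] []
V {suc n} {m} (west π)  = castTimes (sym (+-suc m n)) (later (V π))
V (south π)             = now∷ V π

H : ∀ {n m} → Walk n m → Subsequence n (m + n)
H end                   = subsequence [] []
H {suc n} {m} (west π)  = castTimes (sym (+-suc m n)) (now∷ H π)
H (south π)             = later (H π)

ρ : ∀ n → Vec ℕ n
ρ zero    = []
ρ (suc n) = n ∷ ρ n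

infix 8 _+ρ

_+ρ : ∀ {n} → Partition n → Vec ℕ n
_+ρ {n} α = zipWith _+_ (parts α) (ρ n)

-- A witness of IsOverlap α β κ contains the permutation sending each
-- position of (α + ρₘ) ∪ (β + ρₙ) to the position of the same entry in
-- the strictly decreasing sequence κ + ρₘ₊ₙ.

IsOverlap : ∀ {m n} → Partition m → Partition n → Partition (m + n) → Set
IsOverlap α β κ = lookup (κ +ρ) ↭ lookup (α +ρ ++ β +ρ)

private
  Sorted : ∀ {n} → Vec ℕ n → Set
  Sorted {n} s = Σ[ t ∈ Vec ℕ n ] Linked _≥_ t × (lookup t ↭ lookup s)

  insert : ∀ {n} x (t : Vec ℕ n) → Linked _≥_ t →
           Σ[ u ∈ Vec ℕ (suc n) ] Linked _≥_ u × (lookup u ↭ lookup (x ∷ t)) ×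
           (∀ y → x ≤ y → All (_≤ y) t → All (_≤ y) u)
  insert x [] l = x ∷ [] , [-] , (Perm.id , λ _ → refl) , λ y p ps → p ∷ ps
  insert x (z ∷ t) l with x ≤? z
  ... | no x≰z  = x ∷ z ∷ t , ≰⇒≥ x≰z ∷ l , (Perm.id , λ _ → refl) ,
                  λ y p ps → p ∷ ps
  ... | yes x≤z with insert x t (Linked.tail l)
  ... | u@(_ ∷ _) , lu , (σ , eq) , bound
      with bound z x≤z (All.tail (Linked.Linked⇒All (flip ≤-trans) ≤-refl l))
  ... | h ∷ _ =
      z ∷ u , h ∷ lu , (Perm.swap Perm.id ∘ₚ Perm.lift₀ σ , eq′) ,
      λ { y p (q ∷ qs) → q ∷ bound y p qs }
    where
    eq′ : ∀ i → lookup (z ∷ u) ((Perm.swap Perm.id ∘ₚ Perm.lift₀ σ) ⟨$⟩ʳ i)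
              ≡ lookup (x ∷ z ∷ t) i
    eq′ zero          = eq zero
    eq′ (suc zero)    = refl
    eq′ (suc (suc i)) = eq (suc i)

  sort : ∀ {n} (s : Vec ℕ n) → Sorted s
  sort []      = [] , [] , (Perm.id , λ ())
  sort (x ∷ s) with sort s
  ... | t , l , (σ , eq) with insert x t l
  ... | u , lu , (τ , eq′) , _ = u , lu , (Perm.lift₀ σ ∘ₚ τ , eq″)
    where
    eq″ : ∀ i → lookup u ((Perm.lift₀ σ ∘ₚ τ) ⟨$⟩ʳ i) ≡ lookup (x ∷ s) i
    eq″ zero    = eq′ zero
    eq″ (suc i) = trans (eq′ (suc (σ ⟨$⟩ʳ i))) (eq i)

Distinct : ∀ {n} → Vec ℕ n → Set
Distinct t = ∀ i j → lookup t i ≡ lookup t j → i ≡ j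

↭-distinct : ∀ {n} {t s : Vec ℕ n} → lookup t ↭ lookup s → Distinct t → Distinct s
↭-distinct (σ , eq) d i j e =
  trans (sym (Perm.inverseˡ σ)) (trans (cong (σ ⟨$⟩ˡ_) σi≡σj) (Perm.inverseˡ σ))
  where
  σi≡σj : σ ⟨$⟩ʳ i ≡ σ ⟨$⟩ʳ j
  σi≡σj = d _ _ (trans (eq i) (trans e (sym (eq j))))

↭-sym : ∀ {n} {t s : Vec ℕ n} → lookup t ↭ lookup s → lookup s ↭ lookup t
↭-sym {t = t} (σ , eq) =
  Perm.flip σ , λ i → trans (sym (eq _)) (cong (lookup t) (Perm.inverseʳ σ))

distinct⇒strict : ∀ {n} {t : Vec ℕ n} → Linked _≥_ t → Distinct t → Linked _>_ t
distinct⇒strict []  d = []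
distinct⇒strict [-] d = [-]
distinct⇒strict {t = _ ∷ _ ∷ _} (p ∷ l) d =
  ≤∧≢⇒< p (λ e → contradiction (d (suc zero) zero e) λ ()) ∷
  distinct⇒strict l (λ i j e → Fin.suc-injective (d (suc i) (suc j) e))

strict⇒distinct : ∀ {n} {t : Vec ℕ n} → Linked _>_ t → Distinct t
strict⇒distinct l i j e with Fin.<-cmp i j
... | tri< p _ _ = contradiction (sym e) (<⇒≢ (Linked.lookup⁺ (flip <-trans) l p))
... | tri≈ _ p _ = p
... | tri> _ _ p = contradiction e (<⇒≢ (Linked.lookup⁺ (flip <-trans) l p))

+ρ-strict : ∀ {n} {as : Vec ℕ n} → Linked _≥_ as → Linked _>_ (zipWith _+_ as (ρ n))
+ρ-strict []  = []
+ρ-strict [-] = [-]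
+ρ-strict {as = _ ∷ _ ∷ _} (p ∷ l) = +-mono-≤-< p (n<1+n _) ∷ +ρ-strict l

head-≥ : ∀ {n} {t : Vec ℕ (suc n)} → Linked _>_ t → n ≤ Vec.head t
head-≥ [-]                     = z≤n
head-≥ {t = _ ∷ _ ∷ _} (p ∷ l) = ≤-<-trans (head-≥ l) p

subtract-ρ : ∀ {n} {t : Vec ℕ n} → Linked _>_ t →
             Σ[ as ∈ Vec ℕ n ] Linked _≥_ as × zipWith _+_ as (ρ n) ≡ t
subtract-ρ {n} {t} l = zipWith _∸_ t (ρ n) , go l , back l
  where
  go : ∀ {n} {t : Vec ℕ n} → Linked _>_ t → Linked _≥_ (zipWith _∸_ t (ρ n))
  go []  = []
  go [-] = [-]
  go {suc (suc n)} {_ ∷ _ ∷ _} (p ∷ l) = ∸-monoˡ-≤ (suc n) p ∷ go l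

  back : ∀ {n} {t : Vec ℕ n} → Linked _>_ t →
         zipWith _+_ (zipWith _∸_ t (ρ n)) (ρ n) ≡ t
  back {t = []}    l = refl
  back {t = _ ∷ _} l = cong₂ _∷_ (m∸n+n≡m (head-≥ l)) (back (Linked.tail l))

-- An overlap exists exactly when the entries of (α + ρₘ) ∪ (β + ρₙ) are
-- pairwise distinct; this is decided by sorting them.

overlap? : ∀ {m n} (α : Partition m) (β : Partition n) → Dec (∃[ κ ] IsOverlap α β κ)
overlap? α β with sort (α +ρ ++ β +ρ)
... | t , l , t↭s with Linked.linked? _>?_ t
... | no ¬strict = no λ (κ , κ↭s) → ¬strict
  (distinct⇒strict l
    (↭-distinct {t = α +ρ ++ β +ρ} {s = t} (↭-sym {t = t} {s = α +ρ ++ β +ρ} t↭s)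
      (↭-distinct {t = κ +ρ} {s = α +ρ ++ β +ρ} κ↭s
        (strict⇒distinct (+ρ-strict (nonincreasing κ))))))
... | yes strict with subtract-ρ strict
... | as , las , eq =
  yes (partition as las , subst (λ u → lookup u ↭ lookup (α +ρ ++ β +ρ)) (sym eq) t↭s)

infixl 7 _⋆_

-- The value nothing plays the role of ∞.

_⋆_ : ∀ {m n} → Partition m → Partition n → Maybe (Partition (m + n))
α ⋆ β with overlap? α β
... | yes (κ , _) = just κ
... | no  _       = nothing

inversions : ∀ {N} → Permutation′ N → ℕ
inversions {N} σ = Vec.sum (tabulate {n = N} (λ i →
  count (λ j → (i Fin.<? j) ×-dec ((σ ⟨$⟩ʳ j) Fin.<? (σ ⟨$⟩ʳ i))) (allFin N)))

sign : ∀ {N} → Permutation′ N → ℤ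
sign σ = -1ℤ ℤ.^ inversions σ

-- The sorting permutation is unique because κ + ρₘ₊ₙ is strictly
-- decreasing, so the choice of witness is immaterial.

ε : ∀ {m n} → Partition m → Partition n → ℤ
ε α β with overlap? α β
... | yes (_ , σ , _) = sign σ
... | no  _           = 1ℤ

OverlapPairs : ∀ m n → Partition (m + n) → Set
OverlapPairs m n κ =
  Σ[ p ∈ Partition m × Partition n ] proj₁ p ⋆ proj₂ p ≡ just κ

{-# OPTIONS --safe #-}
module Submission where

-- The entry of ρₘ₊ₙ at a time t counts the steps of π after t.  After the
-- i-th south step there remain μ(π)ᵢ west and (ρₘ)ᵢ south steps, after the
-- j-th west step ν(π)′ⱼ south and (ρₙ)ⱼ west steps.  So adding ρₘ and ρₙ to
-- the two partitions attached to π gives the restrictions of the strictly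
-- decreasing sequence κ + ρₘ₊ₙ to V(π) and to H(π): their overlap is κ, and
-- since its entries are distinct they determine V(π), hence π.  The sorting
-- permutation is the shuffle listing V(π) and then H(π), whose inversions
-- are the pairs of a west step before a south step, that is, the boxes
-- below π.  Conversely, if κ is the overlap of α and β, the sorting
-- permutation increases on the first m and on the last n positions, so
-- merging its two halves yields a walk; every value of a permutation of
-- {0,…,N-1} being its own rank, the step times of this walk are the values
-- of the permutation.

open import Defs
open import Axiom.UniquenessOfIdentityProofs.WithK using (uip)
open import Data.Bool.Base using (true; false; if_then_else_)
open import Data.Fin.Base as Fin using (Fin; zero; suc; toℕ; opposite; _↑ˡ_; _↑ʳ_)
import Data.Fin.Properties as Fin
open import Data.Fin.Permutation as Perm using (Permutation′; _⟨$⟩ʳ_; _⟨$⟩ˡ_)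
open import Data.Integer.Base using (-1ℤ; _^_)
open import Data.Maybe.Base using (just)
open import Data.Maybe.Properties using (just-injective)
open import Data.Nat.Base
  using (ℕ; zero; suc; _+_; _*_; _∸_; _≤_; _<_; z≤n; s≤s; z<s; s<s; s<s⁻¹)
open import Data.Nat.Properties
open import Algebra.Properties.CommutativeMonoid.Sum +-0-commutativeMonoid
  using (sum; sum-syntax; sum-cong-≗; sum-permute; sum-replicate-zero)
open import Data.Product.Base using (Σ-syntax; ∃-syntax; _×_; _,_; proj₁; proj₂)
open import Data.Vec.Base as Vec using (Vec; []; _∷_; _++_; lookup; tabulate; count)
open import Data.Vec.Properties
  using (lookup-map; lookup-zipWith; lookup∘tabulate; tabulate∘lookup; tabulate-cong;
         lookup-++ˡ; lookup-++ʳ)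
import Data.Vec.Relation.Unary.All.Properties as All
import Data.Vec.Relation.Unary.Linked.Properties as Linked
open import Function.Base using (_∘_; flip; id)
open import Function.Bundles using (_⤖_; mk⤖; module Bijection)
open import Function.Consequences.Propositional using (strictlySurjective⇒surjective)
open import Function.Definitions using (Injective)
open import Relation.Binary.Definitions using (tri<; tri≈; tri>)
open import Relation.Binary.PropositionalEquality
open import Relation.Nullary.Decidable using (Dec; yes; no; does; _×-dec_; dec-true; dec-false)
open import Relation.Nullary.Negation using (¬_; contradiction)
open import Relation.Unary using (Decidable)

open ≡-Reasoning

-- Indicators and finite sums.

𝟙 : {P : Set} → Dec P → ℕ
𝟙 P? = if does P? then 1 else 0

𝟙-yes : {P : Set} (P? : Dec P) → P → 𝟙 P? ≡ 1
𝟙-yes P? p = cong (if_then 1 else 0) (dec-true P? p)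

𝟙-no : {P : Set} (P? : Dec P) → ¬ P → 𝟙 P? ≡ 0
𝟙-no P? ¬p = cong (if_then 1 else 0) (dec-false P? ¬p)

𝟙-cong : {P Q : Set} (P? : Dec P) (Q? : Dec Q) → (P → Q) → (Q → P) → 𝟙 P? ≡ 𝟙 Q?
𝟙-cong (yes p) Q? f g = sym (𝟙-yes Q? (f p))
𝟙-cong (no ¬p) Q? f g = sym (𝟙-no Q? (¬p ∘ g))

𝟙-suc : ∀ a b → 𝟙 (suc a <? suc b) ≡ 𝟙 (a <? b)
𝟙-suc a b = 𝟙-cong (suc a <? suc b) (a <? b) s<s⁻¹ s<s

𝟙-<-cong : ∀ {a b c d} → a ≡ c → b ≡ d → 𝟙 (a <? b) ≡ 𝟙 (c <? d)
𝟙-<-cong refl refl = refl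

sum-zero : ∀ {n} (f : Fin n → ℕ) → (∀ i → f i ≡ 0) → sum f ≡ 0
sum-zero {n} f f≗0 = trans (sum-cong-≗ f≗0) (sum-replicate-zero n)

sum-one : ∀ {n} (f : Fin n → ℕ) → (∀ i → f i ≡ 1) → sum f ≡ n
sum-one {zero}  f f≗1 = refl
sum-one {suc n} f f≗1 = cong₂ _+_ (f≗1 zero) (sum-one (f ∘ suc) (f≗1 ∘ suc))

sum-splitAt : ∀ m {n} (f : Fin (m + n) → ℕ) →
              sum f ≡ sum (λ i → f (i ↑ˡ n)) + sum (λ j → f (m ↑ʳ j))
sum-splitAt zero    f = refl
sum-splitAt (suc m) f =
  trans (cong (f zero +_) (sum-splitAt m (f ∘ suc))) (sym (+-assoc (f zero) _ _))

sum-opposite : ∀ {n} (f : Fin n → ℕ) → sum (λ i → f (opposite i)) ≡ sum f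
sum-opposite f = sym (sum-permute f Perm.reverse)

sum-tabulate : ∀ {n} (f : Fin n → ℕ) → Vec.sum (tabulate f) ≡ sum f
sum-tabulate {zero}  f = refl
sum-tabulate {suc n} f = cong (f zero +_) (sum-tabulate (f ∘ suc))

count-tabulate : ∀ {A : Set} {n} {P : A → Set} (P? : Decidable P) (f : Fin n → A) →
                 count P? (tabulate f) ≡ sum (λ i → 𝟙 (P? (f i)))
count-tabulate {n = zero}  P? f = refl
count-tabulate {n = suc n} P? f with does (P? (f zero))
... | true  = cong suc (count-tabulate P? (f ∘ suc))
... | false = count-tabulate P? (f ∘ suc)

-- Ranks and permutations of a finite set.

count-below : ∀ {N k} → k ≤ N → ∑[ y < N ] 𝟙 (toℕ y <? k) ≡ k
count-below {N} z≤n   = sum-zero {N} _ (λ _ → refl)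
count-below {suc N} (s≤s {k} k≤N) =
  cong suc (trans (sum-cong-≗ (λ (y : Fin N) → 𝟙-suc (toℕ y) k)) (count-below k≤N))

-- Reindexing by `σ` turns the sum over positions into a sum over all values, where `count-below`
-- applies.
permutation-rank : ∀ {N} (σ : Permutation′ N) x →
  ∑[ y < N ] 𝟙 (toℕ (σ ⟨$⟩ʳ y) <? toℕ (σ ⟨$⟩ʳ x)) ≡ toℕ (σ ⟨$⟩ʳ x)
permutation-rank σ x = trans
  (sym (sum-permute (λ y → 𝟙 (toℕ y <? toℕ (σ ⟨$⟩ʳ x))) σ))
  (count-below (<⇒≤ (Fin.toℕ<n (σ ⟨$⟩ʳ x))))

⟨$⟩ʳ-injective : ∀ {N} (σ : Permutation′ N) → Injective _≡_ _≡_ (σ ⟨$⟩ʳ_)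
⟨$⟩ʳ-injective σ e =
  trans (sym (Perm.inverseˡ σ)) (trans (cong (σ ⟨$⟩ˡ_) e) (Perm.inverseˡ σ))

-- The value at `x` is its own rank among all values; since `σ` preserves and reflects the order,
-- this is also the rank of `x` among all positions, namely `x`.
increasing-permutation : ∀ {N} (σ : Permutation′ N) →
  (∀ x y → (σ ⟨$⟩ʳ x) Fin.< (σ ⟨$⟩ʳ y) → x Fin.< y) →
  (∀ x y → x Fin.< y → (σ ⟨$⟩ʳ x) Fin.< (σ ⟨$⟩ʳ y)) → ∀ x → σ ⟨$⟩ʳ x ≡ x
increasing-permutation {N} σ reflects preserves x = Fin.toℕ-injective (begin
  toℕ (σ ⟨$⟩ʳ x)
    ≡⟨ permutation-rank σ x ⟨
  ∑[ y < N ] 𝟙 (toℕ (σ ⟨$⟩ʳ y) <? toℕ (σ ⟨$⟩ʳ x))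
    ≡⟨ sum-cong-≗ (λ (y : Fin N) → 𝟙-cong (_ <? _) (toℕ y <? toℕ x) (reflects y x) (preserves y x)) ⟩
  ∑[ y < N ] 𝟙 (toℕ y <? toℕ x)
    ≡⟨ count-below (<⇒≤ (Fin.toℕ<n x)) ⟩
  toℕ x ∎)

-- Pigeonhole: if `y` were missed, punching it out of the codomain would embed `suc N` elements into
-- `N`.
injective⇒surjective : ∀ {N} {f : Fin N → Fin N} → Injective _≡_ _≡_ f → ∀ y → ∃[ x ] f x ≡ y
injective⇒surjective {suc N} {f} inj y with Fin.any? (λ x → f x Fin.≟ y)
... | yes found = found
... | no ¬found = contradiction
  (Fin.injective⇒≤ {f = λ x → Fin.punchOut (y≢f x)}
    (λ {x} {x′} e → inj (Fin.punchOut-injective (y≢f x) (y≢f x′) e)))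
  1+n≰n
  where
  y≢f : ∀ x → y ≢ f x
  y≢f x e = ¬found (x , sym e)

injective⇒permutation : ∀ {N} (f : Fin N → Fin N) → Injective _≡_ _≡_ f →
                        Σ[ σ ∈ Permutation′ N ] (∀ i → σ ⟨$⟩ʳ i ≡ f i)
injective⇒permutation f inj =
  Perm.permutation f (proj₁ ∘ preimage) (proj₂ ∘ preimage)
    (λ i → inj (proj₂ (preimage (f i)))) ,
  λ _ → refl
  where
  preimage : ∀ y → ∃[ x ] f x ≡ y
  preimage = injective⇒surjective inj

-- Times of the south and west steps, counted from 0.

Vᵗ : ∀ {n m} → Walk n m → Fin m → Fin (m + n)
Vᵗ π = lookup (indices (V π))

Hᵗ : ∀ {n m} → Walk n m → Fin n → Fin (m + n)
Hᵗ π = lookup (indices (H π))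

lookup-castTimes : ∀ {k M N} .(eq : M ≡ N) (K : Subsequence k M) i →
                   toℕ (lookup (indices (castTimes eq K)) i) ≡ toℕ (lookup (indices K) i)
lookup-castTimes eq K i = trans
  (cong toℕ (lookup-map i (Fin.cast eq) (indices K)))
  (Fin.toℕ-cast eq (lookup (indices K) i))

lookup-later : ∀ {k N} (K : Subsequence k N) i →
               toℕ (lookup (indices (later K)) i) ≡ suc (toℕ (lookup (indices K) i))
lookup-later K i = cong toℕ (lookup-map i suc (indices K))

module _ {n m} (π : Walk n m) where

  V-west : ∀ i → toℕ (Vᵗ (west π) i) ≡ suc (toℕ (Vᵗ π i))
  V-west i = trans (lookup-castTimes (sym (+-suc m n)) (later (V π)) i) (lookup-later (V π) i)

  V-south : ∀ i → toℕ (Vᵗ (south π) (suc i)) ≡ suc (toℕ (Vᵗ π i))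
  V-south = lookup-later (V π)

  H-now : toℕ (Hᵗ (west π) zero) ≡ 0
  H-now = lookup-castTimes (sym (+-suc m n)) (now∷ H π) zero

  H-west : ∀ j → toℕ (Hᵗ (west π) (suc j)) ≡ suc (toℕ (Hᵗ π j))
  H-west j = trans (lookup-castTimes (sym (+-suc m n)) (now∷ H π) (suc j)) (lookup-later (H π) j)

  H-south : ∀ j → toℕ (Hᵗ (south π) j) ≡ suc (toℕ (Hᵗ π j))
  H-south = lookup-later (H π)

V≢H : ∀ {n m} (π : Walk n m) i j → toℕ (Vᵗ π i) ≢ toℕ (Hᵗ π j)
V≢H (west π)  i       zero    e = 0≢1+n (trans (sym (H-now π)) (trans (sym e) (V-west π i)))
V≢H (west π)  i       (suc j) e =
  V≢H π i j (suc-injective (trans (sym (V-west π i)) (trans e (H-west π j))))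
V≢H (south π) zero    j       e = 0≢1+n (trans e (H-south π j))
V≢H (south π) (suc i) j       e =
  V≢H π i j (suc-injective (trans (sym (V-south π i)) (trans e (H-south π j))))

-- If the first steps differ, the walk that starts south has its first south step at time 0 and the
-- other one has it later. Equal first steps are removed, which shifts all times by one.
V-injective : ∀ {n m} (π π′ : Walk n m) → (∀ i → Vᵗ π i ≡ Vᵗ π′ i) → π ≡ π′
V-injective end       end        f = refl
V-injective (west π)  (west π′)  f = cong west (V-injective π π′ (λ i →
  Fin.toℕ-injective (suc-injective
    (trans (sym (V-west π i)) (trans (cong toℕ (f i)) (V-west π′ i))))))
V-injective (south π) (south π′) f = cong south (V-injective π π′ (λ i →
  Fin.toℕ-injective (suc-injective
    (trans (sym (V-south π i)) (trans (cong toℕ (f (suc i))) (V-south π′ i))))))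
V-injective (west π)  (south π′) f =
  contradiction (trans (sym (cong toℕ (f zero))) (V-west π zero)) 0≢1+n
V-injective (south π) (west π′)  f =
  contradiction (trans (cong toℕ (f zero)) (V-west π′ zero)) 0≢1+n

subsequence-increasing : ∀ {k N} (K : Subsequence k N) {i j} → i Fin.< j →
                         lookup (indices K) i Fin.< lookup (indices K) j
subsequence-increasing K = Linked.lookup⁺ <-trans (increasing K)

subsequence-injective : ∀ {k N} (K : Subsequence k N) → Injective _≡_ _≡_ (lookup (indices K))
subsequence-injective K {i} {j} e with Fin.<-cmp i j
... | tri< p _ _ = contradiction (cong toℕ e) (<⇒≢ (subsequence-increasing K p))
... | tri≈ _ p _ = p
... | tri> _ _ p = contradiction (cong toℕ (sym e)) (<⇒≢ (subsequence-increasing K p))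

-- The shuffle that lists the south times before the west times; it becomes the sorting permutation
-- of the overlap.
stepTime : ∀ {n m} → Walk n m → Fin (m + n) → Fin (m + n)
stepTime π = lookup (indices (V π) ++ indices (H π))

-- Indexed by the position itself, so that matching on the view replaces the position by `i ↑ˡ n` or
-- `m ↑ʳ j` in the goal.
data SplitView m {n} : Fin (m + n) → Set where
  left  : (i : Fin m) → SplitView m (i ↑ˡ n)
  right : (j : Fin n) → SplitView m (m ↑ʳ j)

splitView : ∀ m {n} x → SplitView m {n} x
splitView zero    x    = right x
splitView (suc m) zero = left zero
splitView (suc m) (suc x) with splitView m x
... | left i  = left (suc i)
... | right j = right j

stepTime-V : ∀ {n m} (π : Walk n m) i → stepTime π (i ↑ˡ n) ≡ Vᵗ π i
stepTime-V π = lookup-++ˡ (indices (V π)) (indices (H π))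

stepTime-H : ∀ {n m} (π : Walk n m) j → stepTime π (m ↑ʳ j) ≡ Hᵗ π j
stepTime-H π = lookup-++ʳ (indices (V π)) (indices (H π))

stepTime-injective : ∀ {n m} (π : Walk n m) → Injective _≡_ _≡_ (stepTime π)
stepTime-injective {n} {m} π {x} {y} e with splitView m x | splitView m y
... | left i  | left k  = cong (_↑ˡ n) (subsequence-injective (V π)
  (trans (sym (stepTime-V π i)) (trans e (stepTime-V π k))))
... | right j | right l = cong (m ↑ʳ_) (subsequence-injective (H π)
  (trans (sym (stepTime-H π j)) (trans e (stepTime-H π l))))
... | left i  | right l = contradiction
  (cong toℕ (trans (sym (stepTime-V π i)) (trans e (stepTime-H π l)))) (V≢H π i l)
... | right j | left k  = contradiction
  (cong toℕ (trans (sym (stepTime-V π k)) (trans (sym e) (stepTime-H π j)))) (V≢H π k j)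

-- Counting the steps that remain after a given step.

ρ-lookup : ∀ {n} (i : Fin n) → lookup (ρ n) i + suc (toℕ i) ≡ n
ρ-lookup {suc n} zero    = +-comm n 1
ρ-lookup {suc n} (suc i) = trans (+-suc (lookup (ρ n) i) (suc (toℕ i))) (cong suc (ρ-lookup i))

-- The first two terms count the west and the south steps after the `i`-th south step. As times
-- start at 0, the `suc` counts the steps up to and including it, so all `m + n` steps are counted
-- once.
μ+ρ : ∀ {n m} (π : Walk n m) i →
      lookup (rowsAbove π) i + lookup (ρ m) i + suc (toℕ (Vᵗ π i)) ≡ m + n
μ+ρ {suc n} {m} (west π) i = begin
  lookup (rowsAbove π) i + lookup (ρ m) i + suc (toℕ (Vᵗ (west π) i))
    ≡⟨ cong (λ t → lookup (rowsAbove π) i + lookup (ρ m) i + suc t) (V-west π i) ⟩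
  lookup (rowsAbove π) i + lookup (ρ m) i + suc (suc (toℕ (Vᵗ π i)))
    ≡⟨ +-suc _ _ ⟩
  suc (lookup (rowsAbove π) i + lookup (ρ m) i + suc (toℕ (Vᵗ π i)))
    ≡⟨ cong suc (μ+ρ π i) ⟩
  suc (m + n)
    ≡⟨ +-suc m n ⟨
  m + suc n ∎
μ+ρ {n} {suc m} (south π) zero    = trans (+-comm (n + m) 1) (cong suc (+-comm n m))
μ+ρ {n} {suc m} (south π) (suc i) = begin
  lookup (rowsAbove π) i + lookup (ρ m) i + suc (toℕ (Vᵗ (south π) (suc i)))
    ≡⟨ cong (λ t → lookup (rowsAbove π) i + lookup (ρ m) i + suc t) (V-south π i) ⟩
  lookup (rowsAbove π) i + lookup (ρ m) i + suc (suc (toℕ (Vᵗ π i)))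
    ≡⟨ +-suc _ _ ⟩
  suc (lookup (rowsAbove π) i + lookup (ρ m) i + suc (toℕ (Vᵗ π i)))
    ≡⟨ cong suc (μ+ρ π i) ⟩
  suc (m + n) ∎

rows-≤ : ∀ {n m} (π : Walk n m) i → lookup (rowsAbove π) i ≤ n
rows-≤ π = All.lookup⁺ (rowsAbove-≤ π)

-- The number of boxes below the walk in the `j`-th column from the right, which is the column
-- crossed by the `j`-th west step.
columnBelow : ∀ {n m} → Walk n m → Fin n → ℕ
columnBelow {n} {m} π j = ∑[ i < m ] 𝟙 (toℕ j <? n ∸ lookup (rowsAbove π) i)

-- The rotation by 180 degrees lists the rows in reverse order, and a column length does not depend
-- on the order of the rows.
lookup-ν′ : ∀ {n m} (π : Walk n m) j → lookup (parts (ν′ π)) j ≡ columnBelow π j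
lookup-ν′ {n} {m} π j = begin
  lookup (parts (ν′ π)) j
    ≡⟨ lookup∘tabulate (λ j → count (toℕ j <?_) (parts (ν π))) j ⟩
  count (toℕ j <?_) (parts (ν π))
    ≡⟨ count-tabulate (toℕ j <?_) (λ i → n ∸ lookup (rowsAbove π) (opposite i)) ⟩
  ∑[ i < m ] 𝟙 (toℕ j <? n ∸ lookup (rowsAbove π) (opposite i))
    ≡⟨ sum-opposite (λ i → 𝟙 (toℕ j <? n ∸ lookup (rowsAbove π) i)) ⟩
  columnBelow π j ∎

columnBelow-west-zero : ∀ {n m} (π : Walk n m) → columnBelow (west π) zero ≡ m
columnBelow-west-zero {n} {m} π = sum-one {m} _ λ i →
  𝟙-yes (0 <? suc n ∸ lookup (rowsAbove π) i) (m<n⇒0<n∸m (s≤s (rows-≤ π i)))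

columnBelow-west-suc : ∀ {n m} (π : Walk n m) j →
                       columnBelow (west π) (suc j) ≡ columnBelow π j
columnBelow-west-suc {n} {m} π j = sum-cong-≗ {m} λ i → trans
  (𝟙-<-cong refl (+-∸-assoc 1 (rows-≤ π i)))
  (𝟙-suc (toℕ j) (n ∸ lookup (rowsAbove π) i))

columnBelow-south : ∀ {n m} (π : Walk n m) j → columnBelow (south π) j ≡ columnBelow π j
columnBelow-south {n} {m} π j = cong (_+ columnBelow π j)
  (𝟙-no (toℕ j <? n ∸ n) (λ p → n≮0 (subst (toℕ j <_) (n∸n≡0 n) p)))

-- The counterpart of `μ+ρ` for west steps: the boxes below the `j`-th west step lie in the rows of
-- the south steps still to come.
ν′+ρ : ∀ {n m} (π : Walk n m) j →
       columnBelow π j + lookup (ρ n) j + suc (toℕ (Hᵗ π j)) ≡ m + n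
ν′+ρ {suc n} {m} (west π) zero = begin
  columnBelow (west π) zero + n + suc (toℕ (Hᵗ (west π) zero))
    ≡⟨ cong₂ (λ c t → c + n + suc t) (columnBelow-west-zero π) (H-now π) ⟩
  m + n + 1
    ≡⟨ +-assoc m n 1 ⟩
  m + (n + 1)
    ≡⟨ cong (m +_) (+-comm n 1) ⟩
  m + suc n ∎
ν′+ρ {suc n} {m} (west π) (suc j) = begin
  columnBelow (west π) (suc j) + lookup (ρ n) j + suc (toℕ (Hᵗ (west π) (suc j)))
    ≡⟨ cong₂ (λ c t → c + lookup (ρ n) j + suc t) (columnBelow-west-suc π j) (H-west π j) ⟩
  columnBelow π j + lookup (ρ n) j + suc (suc (toℕ (Hᵗ π j)))
    ≡⟨ +-suc _ _ ⟩
  suc (columnBelow π j + lookup (ρ n) j + suc (toℕ (Hᵗ π j)))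
    ≡⟨ cong suc (ν′+ρ π j) ⟩
  suc (m + n)
    ≡⟨ +-suc m n ⟨
  m + suc n ∎
ν′+ρ {n} {suc m} (south π) j = begin
  columnBelow (south π) j + lookup (ρ n) j + suc (toℕ (Hᵗ (south π) j))
    ≡⟨ cong₂ (λ c t → c + lookup (ρ n) j + suc t) (columnBelow-south π j) (H-south π j) ⟩
  columnBelow π j + lookup (ρ n) j + suc (suc (toℕ (Hᵗ π j)))
    ≡⟨ +-suc _ _ ⟩
  suc (columnBelow π j + lookup (ρ n) j + suc (toℕ (Hᵗ π j)))
    ≡⟨ cong suc (ν′+ρ π j) ⟩
  suc (m + n) ∎

-- Entries of the two partitions attached to a walk.

lookup-+ρ : ∀ {n} (α : Partition n) i → lookup (α +ρ) i ≡ lookup (parts α) i + lookup (ρ n) i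
lookup-+ρ {n} α i = lookup-zipWith _+_ i (parts α) (ρ n)

-- By `ρ-lookup`, the hypothesis says that the entries of `α` and `ρ k` at `i` add up to the entry
-- of `ρ N` at the time `t` selected by `K`, which is what the entry of `κ` at `t` lacks.
lookup-⊕-↾ : ∀ {k N} (α : Partition k) (κ : Partition N) (K : Subsequence k N) i →
  lookup (parts α) i + lookup (ρ k) i + suc (toℕ (lookup (indices K) i)) ≡ N →
  lookup ((α ⊕ κ ↾ K) +ρ) i ≡ lookup (κ +ρ) (lookup (indices K) i)
lookup-⊕-↾ {k} {N} α κ K i e = begin
  lookup ((α ⊕ κ ↾ K) +ρ) i
    ≡⟨ lookup-+ρ (α ⊕ κ ↾ K) i ⟩
  lookup (parts (α ⊕ κ ↾ K)) i + r
    ≡⟨ cong (_+ r) (lookup-zipWith _+_ i (parts α) (parts (κ ↾ K))) ⟩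
  a + lookup (parts (κ ↾ K)) i + r
    ≡⟨ cong (λ x → a + x + r) (lookup-map i (lookup (parts κ)) (indices K)) ⟩
  a + lookup (parts κ) t + r
    ≡⟨ cong (_+ r) (+-comm a _) ⟩
  lookup (parts κ) t + a + r
    ≡⟨ +-assoc (lookup (parts κ) t) a r ⟩
  lookup (parts κ) t + (a + r)
    ≡⟨ cong (lookup (parts κ) t +_)
         (+-cancelʳ-≡ (suc (toℕ t)) (a + r) (lookup (ρ N) t) (trans e (sym (ρ-lookup t)))) ⟩
  lookup (parts κ) t + lookup (ρ N) t
    ≡⟨ lookup-+ρ κ t ⟨
  lookup (κ +ρ) t ∎
  where
  a = lookup (parts α) i
  r = lookup (ρ k) i
  t = lookup (indices K) i

lookup-V : ∀ {n m} (κ : Partition (m + n)) (π : Walk n m) i →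
           lookup ((μ π ⊕ κ ↾ V π) +ρ) i ≡ lookup (κ +ρ) (Vᵗ π i)
lookup-V κ π i = lookup-⊕-↾ (μ π) κ (V π) i (μ+ρ π i)

lookup-H : ∀ {n m} (κ : Partition (m + n)) (π : Walk n m) j →
           lookup ((ν′ π ⊕ κ ↾ H π) +ρ) j ≡ lookup (κ +ρ) (Hᵗ π j)
lookup-H {n} κ π j = lookup-⊕-↾ (ν′ π) κ (H π) j
  (trans (cong (λ c → c + lookup (ρ n) j + suc (toℕ (Hᵗ π j))) (lookup-ν′ π j)) (ν′+ρ π j))

-- Strictly decreasing sequences and uniqueness of the overlap.

lookup-injective : ∀ {n} {as bs : Vec ℕ n} → (∀ i → lookup as i ≡ lookup bs i) → as ≡ bs
lookup-injective {as = as} {bs} e =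
  trans (sym (tabulate∘lookup as)) (trans (tabulate-cong e) (tabulate∘lookup bs))

+ρ-injective : ∀ {n} {α β : Partition n} → (∀ i → lookup (α +ρ) i ≡ lookup (β +ρ) i) → α ≡ β
+ρ-injective {n} {α} {β} e = Partition-≡ (lookup-injective λ i →
  +-cancelʳ-≡ (lookup (ρ n) i) (lookup (parts α) i) (lookup (parts β) i)
    (trans (sym (lookup-+ρ α i)) (trans (e i) (lookup-+ρ β i))))

+ρ-decreasing : ∀ {n} (α : Partition n) {i j} → i Fin.< j → lookup (α +ρ) j < lookup (α +ρ) i
+ρ-decreasing α = Linked.lookup⁺ (flip <-trans) (+ρ-strict (nonincreasing α))

+ρ-reflects : ∀ {n} (α : Partition n) {i j} → lookup (α +ρ) j < lookup (α +ρ) i → i Fin.< j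
+ρ-reflects α {i} {j} p with Fin.<-cmp i j
... | tri< i<j _    _   = i<j
... | tri≈ _   refl _   = contradiction p (<-irrefl refl)
... | tri> _   _    j<i = contradiction p (<-asym (+ρ-decreasing α j<i))

+ρ-distinct : ∀ {n} (α : Partition n) → Distinct (α +ρ)
+ρ-distinct α = strict⇒distinct (+ρ-strict (nonincreasing α))

-- Undoing one sorting permutation and applying the other carries `κ′ +ρ` to `κ +ρ`. Both sequences
-- are strictly decreasing, so this permutation is increasing and hence the identity.
overlap-unique : ∀ {m n} (α : Partition m) (β : Partition n) {κ κ′ : Partition (m + n)} →
                 IsOverlap α β κ → IsOverlap α β κ′ → κ ≡ κ′
overlap-unique α β {κ} {κ′} (σ , e) (σ′ , e′) = +ρ-injective λ x →
  trans (cong (lookup (κ +ρ)) (sym (τ-id x))) (τ-eq x)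
  where
  τ = Perm.flip σ′ Perm.∘ₚ σ

  τ-eq : ∀ x → lookup (κ +ρ) (τ ⟨$⟩ʳ x) ≡ lookup (κ′ +ρ) x
  τ-eq x = trans (e (σ′ ⟨$⟩ˡ x))
    (trans (sym (e′ (σ′ ⟨$⟩ˡ x))) (cong (lookup (κ′ +ρ)) (Perm.inverseʳ σ′)))

  τ-id : ∀ x → τ ⟨$⟩ʳ x ≡ x
  τ-id = increasing-permutation τ
    (λ x y p → +ρ-reflects κ′ (subst₂ _<_ (τ-eq y) (τ-eq x) (+ρ-decreasing κ p)))
    (λ x y p → +ρ-reflects κ (subst₂ _<_ (sym (τ-eq y)) (sym (τ-eq x)) (+ρ-decreasing κ′ p)))

overlap⇒⋆ : ∀ {m n} (α : Partition m) (β : Partition n) (κ : Partition (m + n)) →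
            IsOverlap α β κ → α ⋆ β ≡ just κ
overlap⇒⋆ α β κ w with overlap? α β
... | yes (κ′ , w′) = cong just (overlap-unique α β {κ′} {κ} w′ w)
... | no ¬w         = contradiction (κ , w) ¬w

⋆⇒overlap : ∀ {m n} (α : Partition m) (β : Partition n) {κ : Partition (m + n)} →
            α ⋆ β ≡ just κ → IsOverlap α β κ
⋆⇒overlap α β e with overlap? α β
... | yes (κ′ , w) = subst (IsOverlap α β) (just-injective e) w
⋆⇒overlap α β () | no _

-- Inversions, signs and boxes below the walk.

inversions-sum : ∀ {N} (σ : Permutation′ N) → inversions σ ≡
  ∑[ i < N ] ∑[ j < N ] 𝟙 ((i Fin.<? j) ×-dec ((σ ⟨$⟩ʳ j) Fin.<? (σ ⟨$⟩ʳ i)))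
inversions-sum {N} σ = trans (sum-tabulate {N} _)
  (sum-cong-≗ {N} λ i →
     count-tabulate (λ j → (i Fin.<? j) ×-dec ((σ ⟨$⟩ʳ j) Fin.<? (σ ⟨$⟩ʳ i))) id)

inversions-cong : ∀ {N} (σ τ : Permutation′ N) → (∀ i → σ ⟨$⟩ʳ i ≡ τ ⟨$⟩ʳ i) →
                  inversions σ ≡ inversions τ
inversions-cong {N} σ τ e = begin
  inversions σ
    ≡⟨ inversions-sum σ ⟩
  ∑[ i < N ] ∑[ j < N ] 𝟙 ((i Fin.<? j) ×-dec ((σ ⟨$⟩ʳ j) Fin.<? (σ ⟨$⟩ʳ i)))
    ≡⟨ sum-cong-≗ {N} (λ i → sum-cong-≗ {N} λ j →
         cong₂ (λ x y → 𝟙 ((i Fin.<? j) ×-dec (x Fin.<? y))) (e j) (e i)) ⟩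
  ∑[ i < N ] ∑[ j < N ] 𝟙 ((i Fin.<? j) ×-dec ((τ ⟨$⟩ʳ j) Fin.<? (τ ⟨$⟩ʳ i)))
    ≡⟨ inversions-sum τ ⟨
  inversions τ ∎

-- The permutation inside `ε` comes from the sorting algorithm; as the entries of `κ +ρ` are
-- distinct, it agrees pointwise with that of any other witness.
overlap⇒ε : ∀ {m n} (α : Partition m) (β : Partition n) (κ : Partition (m + n)) →
            (w : IsOverlap α β κ) → ε α β ≡ sign (proj₁ w)
overlap⇒ε α β κ w@(σ , e) with overlap? α β
... | no ¬w = contradiction (κ , w) ¬w
... | yes (κ′ , w′@(σ′ , e′)) with overlap-unique α β {κ′} {κ} w′ w
... | refl = cong (-1ℤ ^_) (inversions-cong σ′ σ λ i →
  +ρ-distinct κ _ _ (trans (e′ i) (sym (e i))))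

module _ {m n} (α : Partition m) (β : Partition n) (κ : Partition (m + n))
         (w : IsOverlap α β κ) where

  private σ = proj₁ w

  overlapˡ : ∀ i → lookup (κ +ρ) (σ ⟨$⟩ʳ (i ↑ˡ n)) ≡ lookup (α +ρ) i
  overlapˡ i = trans (proj₂ w (i ↑ˡ n)) (lookup-++ˡ (α +ρ) (β +ρ) i)

  overlapʳ : ∀ j → lookup (κ +ρ) (σ ⟨$⟩ʳ (m ↑ʳ j)) ≡ lookup (β +ρ) j
  overlapʳ j = trans (proj₂ w (m ↑ʳ j)) (lookup-++ʳ (α +ρ) (β +ρ) j)

  overlapˡ-increasing : ∀ {i k} → i Fin.< k → (σ ⟨$⟩ʳ (i ↑ˡ n)) Fin.< (σ ⟨$⟩ʳ (k ↑ˡ n))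
  overlapˡ-increasing {i} {k} p = +ρ-reflects κ
    (subst₂ _<_ (sym (overlapˡ k)) (sym (overlapˡ i)) (+ρ-decreasing α p))

  overlapʳ-increasing : ∀ {j l} → j Fin.< l → (σ ⟨$⟩ʳ (m ↑ʳ j)) Fin.< (σ ⟨$⟩ʳ (m ↑ʳ l))
  overlapʳ-increasing {j} {l} p = +ρ-reflects κ
    (subst₂ _<_ (sym (overlapʳ l)) (sym (overlapʳ j)) (+ρ-decreasing β p))

↑ˡ<↑ʳ : ∀ {m n} (i : Fin m) (j : Fin n) → (i ↑ˡ n) Fin.< (m ↑ʳ j)
↑ˡ<↑ʳ {m} {n} i j = subst₂ _<_ (sym (Fin.toℕ-↑ˡ i n)) (sym (Fin.toℕ-↑ʳ m j))
  (≤-trans (Fin.toℕ<n i) (m≤m+n m (toℕ j)))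

↑ˡ-reflects : ∀ {m} n {i k : Fin m} → (i ↑ˡ n) Fin.< (k ↑ˡ n) → i Fin.< k
↑ˡ-reflects n {i} {k} = subst₂ _<_ (Fin.toℕ-↑ˡ i n) (Fin.toℕ-↑ˡ k n)

↑ʳ-reflects : ∀ m {n} {j l : Fin n} → (m ↑ʳ j) Fin.< (m ↑ʳ l) → j Fin.< l
↑ʳ-reflects m {j = j} {l} p =
  +-cancelˡ-< m (toℕ j) (toℕ l) (subst₂ _<_ (Fin.toℕ-↑ʳ m j) (Fin.toℕ-↑ʳ m l) p)

-- Pairs within one block are in order by monotonicity, and a right position never precedes a left
-- one. What remains are the pairs of a left and a right position.
shuffle-inversions : ∀ {m n} (σ : Permutation′ (m + n)) →
  (∀ {i k} → i Fin.< k → (σ ⟨$⟩ʳ (i ↑ˡ n)) Fin.< (σ ⟨$⟩ʳ (k ↑ˡ n))) →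
  (∀ {j l} → j Fin.< l → (σ ⟨$⟩ʳ (m ↑ʳ j)) Fin.< (σ ⟨$⟩ʳ (m ↑ʳ l))) →
  inversions σ ≡
  ∑[ i < m ] ∑[ j < n ] 𝟙 (toℕ (σ ⟨$⟩ʳ (m ↑ʳ j)) <? toℕ (σ ⟨$⟩ʳ (i ↑ˡ n)))
shuffle-inversions {m} {n} σ incˡ incʳ = begin
  inversions σ
    ≡⟨ inversions-sum σ ⟩
  ∑[ x < m + n ] ∑[ y < m + n ] inv x y
    ≡⟨ sum-splitAt m (λ x → ∑[ y < m + n ] inv x y) ⟩
  ∑[ i < m ] ∑[ y < m + n ] inv (i ↑ˡ n) y + ∑[ j < n ] ∑[ y < m + n ] inv (m ↑ʳ j) y
    ≡⟨ cong₂ _+_ (sum-cong-≗ {m} row-left) (sum-zero {n} _ row-right) ⟩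
  ∑[ i < m ] ∑[ j < n ] 𝟙 (toℕ (σ ⟨$⟩ʳ (m ↑ʳ j)) <? toℕ (σ ⟨$⟩ʳ (i ↑ˡ n))) + 0
    ≡⟨ +-identityʳ _ ⟩
  ∑[ i < m ] ∑[ j < n ] 𝟙 (toℕ (σ ⟨$⟩ʳ (m ↑ʳ j)) <? toℕ (σ ⟨$⟩ʳ (i ↑ˡ n))) ∎
  where
  inv? : ∀ x y → Dec (x Fin.< y × (σ ⟨$⟩ʳ y) Fin.< (σ ⟨$⟩ʳ x))
  inv? x y = (x Fin.<? y) ×-dec ((σ ⟨$⟩ʳ y) Fin.<? (σ ⟨$⟩ʳ x))

  inv : Fin (m + n) → Fin (m + n) → ℕ
  inv x y = 𝟙 (inv? x y)

  row-left : ∀ i → ∑[ y < m + n ] inv (i ↑ˡ n) y ≡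
             ∑[ j < n ] 𝟙 (toℕ (σ ⟨$⟩ʳ (m ↑ʳ j)) <? toℕ (σ ⟨$⟩ʳ (i ↑ˡ n)))
  row-left i = trans (sum-splitAt m (inv (i ↑ˡ n))) (cong₂ _+_
    (sum-zero {m} _ λ k → 𝟙-no (inv? (i ↑ˡ n) (k ↑ˡ n))
      λ (p , q) → <-asym q (incˡ (↑ˡ-reflects n p)))
    (sum-cong-≗ {n} λ j → 𝟙-cong (inv? (i ↑ˡ n) (m ↑ʳ j)) (_ <? _)
      proj₂ (λ q → ↑ˡ<↑ʳ i j , q)))

  row-right : ∀ j → ∑[ y < m + n ] inv (m ↑ʳ j) y ≡ 0
  row-right j = trans (sum-splitAt m (inv (m ↑ʳ j))) (cong₂ _+_
    (sum-zero {m} _ λ k → 𝟙-no (inv? (m ↑ʳ j) (k ↑ˡ n))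
      λ (p , _) → <-asym p (↑ˡ<↑ʳ k j))
    (sum-zero {n} _ λ l → 𝟙-no (inv? (m ↑ʳ j) (m ↑ʳ l))
      λ (p , q) → <-asym q (incʳ (↑ʳ-reflects m p))))

-- Of the `n` west steps, those still to come at the `i`-th south step number
-- `lookup (rowsAbove π) i`. The others correspond to the boxes of row `i` below the walk.
westBefore : ∀ {n m} (π : Walk n m) i →
  ∑[ j < n ] 𝟙 (toℕ (Hᵗ π j) <? toℕ (Vᵗ π i)) ≡ n ∸ lookup (rowsAbove π) i
westBefore {suc n} (west π) i = begin
  ∑[ j < suc n ] 𝟙 (toℕ (Hᵗ (west π) j) <? toℕ (Vᵗ (west π) i))
    ≡⟨ cong₂ _+_
         (trans (𝟙-<-cong (H-now π) (V-west π i)) (𝟙-yes (0 <? suc (toℕ (Vᵗ π i))) z<s))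
         (sum-cong-≗ {n} λ j → trans
           (𝟙-<-cong (H-west π j) (V-west π i)) (𝟙-suc (toℕ (Hᵗ π j)) (toℕ (Vᵗ π i)))) ⟩
  suc (∑[ j < n ] 𝟙 (toℕ (Hᵗ π j) <? toℕ (Vᵗ π i)))
    ≡⟨ cong suc (westBefore π i) ⟩
  suc (n ∸ lookup (rowsAbove π) i)
    ≡⟨ +-∸-assoc 1 (rows-≤ π i) ⟨
  suc n ∸ lookup (rowsAbove π) i ∎
westBefore {n} (south π) zero =
  trans (sum-zero {n} _ (λ j → 𝟙-no (toℕ (Hᵗ (south π) j) <? 0) n≮0)) (sym (n∸n≡0 n))
westBefore {n} (south π) (suc i) = trans
  (sum-cong-≗ {n} λ j → trans
    (𝟙-<-cong (H-south π j) (V-south π i)) (𝟙-suc (toℕ (Hᵗ π j)) (toℕ (Vᵗ π i))))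
  (westBefore π i)

∣ν∣ : ∀ {n m} (π : Walk n m) → ∣ ν π ∣ ≡ ∑[ i < m ] (n ∸ lookup (rowsAbove π) i)
∣ν∣ {n} {m} π = trans (sum-tabulate {m} _) (sum-opposite {m} (λ i → n ∸ lookup (rowsAbove π) i))

complement-sum : ∀ {n m} (as : Vec ℕ m) → (∀ i → lookup as i ≤ n) →
                 ∑[ i < m ] (n ∸ lookup as i) + Vec.sum as ≡ m * n
complement-sum []       le = refl
complement-sum {n} {suc m} (a ∷ as) le = begin
  (n ∸ a + s) + (a + Vec.sum as)
    ≡⟨ cong (_+ (a + Vec.sum as)) (+-comm (n ∸ a) s) ⟩
  (s + (n ∸ a)) + (a + Vec.sum as)
    ≡⟨ +-assoc s (n ∸ a) (a + Vec.sum as) ⟩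
  s + ((n ∸ a) + (a + Vec.sum as))
    ≡⟨ cong (s +_) (+-assoc (n ∸ a) a (Vec.sum as)) ⟨
  s + ((n ∸ a + a) + Vec.sum as)
    ≡⟨ cong (λ x → s + (x + Vec.sum as)) (m∸n+n≡m (le zero)) ⟩
  s + (n + Vec.sum as)
    ≡⟨ +-assoc s n (Vec.sum as) ⟨
  s + n + Vec.sum as
    ≡⟨ cong (_+ Vec.sum as) (+-comm s n) ⟩
  n + s + Vec.sum as
    ≡⟨ +-assoc n s (Vec.sum as) ⟩
  n + (s + Vec.sum as)
    ≡⟨ cong (n +_) (complement-sum as (le ∘ suc)) ⟩
  n + m * n ∎
  where s = ∑[ i < m ] (n ∸ lookup as i)

∣ν∣-complement : ∀ {n m} (π : Walk n m) → ∣ ν π ∣ ≡ m * n ∸ ∣ μ π ∣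
∣ν∣-complement {n} {m} π = begin
  ∣ ν π ∣
    ≡⟨ m+n∸n≡m ∣ ν π ∣ ∣ μ π ∣ ⟨
  ∣ ν π ∣ + ∣ μ π ∣ ∸ ∣ μ π ∣
    ≡⟨ cong (λ x → x + ∣ μ π ∣ ∸ ∣ μ π ∣) (∣ν∣ π) ⟩
  ∑[ i < m ] (n ∸ lookup (rowsAbove π) i) + ∣ μ π ∣ ∸ ∣ μ π ∣
    ≡⟨ cong (_∸ ∣ μ π ∣) (complement-sum (rowsAbove π) (rows-≤ π)) ⟩
  m * n ∸ ∣ μ π ∣ ∎

-- From walks to overlaps.

module _ {m n} (κ : Partition (m + n)) (π : Walk n m) where

  stepPermutation : Permutation′ (m + n)
  stepPermutation = proj₁ (injective⇒permutation (stepTime π) (stepTime-injective π))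

  walk⇒overlap : IsOverlap (μ π ⊕ κ ↾ V π) (ν′ π ⊕ κ ↾ H π) κ
  walk⇒overlap = stepPermutation , entries
    where
    α = μ π ⊕ κ ↾ V π
    β = ν′ π ⊕ κ ↾ H π

    entries : ∀ x → lookup (κ +ρ) (stepTime π x) ≡ lookup (α +ρ ++ β +ρ) x
    entries x with splitView m x
    ... | left i  = trans (cong (lookup (κ +ρ)) (stepTime-V π i))
      (trans (sym (lookup-V κ π i)) (sym (lookup-++ˡ (α +ρ) (β +ρ) i)))
    ... | right j = trans (cong (lookup (κ +ρ)) (stepTime-H π j))
      (trans (sym (lookup-H κ π j)) (sym (lookup-++ʳ (α +ρ) (β +ρ) j)))

  stepPermutation-inversions : inversions stepPermutation ≡ ∣ ν π ∣
  stepPermutation-inversions = begin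
    inversions stepPermutation
      ≡⟨ shuffle-inversions stepPermutation
           -- Every sorting permutation of an overlap increases on each block, in particular this
           -- one.
           (overlapˡ-increasing (μ π ⊕ κ ↾ V π) (ν′ π ⊕ κ ↾ H π) κ walk⇒overlap)
           (overlapʳ-increasing (μ π ⊕ κ ↾ V π) (ν′ π ⊕ κ ↾ H π) κ walk⇒overlap) ⟩
    ∑[ i < m ] ∑[ j < n ] 𝟙 (toℕ (stepTime π (m ↑ʳ j)) <? toℕ (stepTime π (i ↑ˡ n)))
      ≡⟨ sum-cong-≗ {m} (λ i → sum-cong-≗ {n} λ j →
           𝟙-<-cong (cong toℕ (stepTime-H π j)) (cong toℕ (stepTime-V π i))) ⟩
    ∑[ i < m ] ∑[ j < n ] 𝟙 (toℕ (Hᵗ π j) <? toℕ (Vᵗ π i))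
      ≡⟨ sum-cong-≗ {m} (westBefore π) ⟩
    ∑[ i < m ] (n ∸ lookup (rowsAbove π) i)
      ≡⟨ ∣ν∣ π ⟨
    ∣ ν π ∣ ∎

-- From overlaps to walks: merging two increasing sequences.

rank : ∀ {m n} → (Fin m → ℕ) → (Fin n → ℕ) → ℕ → ℕ
rank {m} {n} v h x = ∑[ i < m ] 𝟙 (v i <? x) + ∑[ j < n ] 𝟙 (h j <? x)

rank-least : ∀ {m n} (v : Fin m → ℕ) (h : Fin n → ℕ) {x} →
             (∀ i → x ≤ v i) → (∀ j → x ≤ h j) → rank v h x ≡ 0
rank-least {m} {n} v h {x} x≤v x≤h = cong₂ _+_
  (sum-zero {m} _ λ i → 𝟙-no (v i <? x) (≤⇒≯ (x≤v i)))
  (sum-zero {n} _ λ j → 𝟙-no (h j <? x) (≤⇒≯ (x≤h j)))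

rank-tailˡ : ∀ {m n} (v : Fin (suc m) → ℕ) (h : Fin n → ℕ) {x} → v zero < x →
             rank v h x ≡ suc (rank (v ∘ suc) h x)
rank-tailˡ {m} {n} v h {x} p =
  cong (λ a → a + ∑[ i < m ] 𝟙 (v (suc i) <? x) + ∑[ j < n ] 𝟙 (h j <? x))
       (𝟙-yes (v zero <? x) p)

rank-tailʳ : ∀ {m n} (v : Fin m → ℕ) (h : Fin (suc n) → ℕ) {x} → h zero < x →
             rank v h x ≡ suc (rank v (h ∘ suc) x)
rank-tailʳ {m} {n} v h {x} p = trans
  (cong (λ a → ∑[ i < m ] 𝟙 (v i <? x) + (a + ∑[ j < n ] 𝟙 (h (suc j) <? x)))
        (𝟙-yes (h zero <? x) p))
  (+-suc (∑[ i < m ] 𝟙 (v i <? x)) _)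

-- Each west step consumes the head of `h` and each south step the head of `v`; the inequalities say
-- that the consumed entry is the least of all that remain.
data Merges : ∀ {n m} → Walk n m → (Fin m → ℕ) → (Fin n → ℕ) → Set where
  end   : ∀ {v h} → Merges end v h
  west  : ∀ {n m v h} {π : Walk n m} → (∀ i → h zero < v i) → (∀ j → h zero < h (suc j)) →
          Merges π v (h ∘ suc) → Merges (west π) v h
  south : ∀ {n m v h} {π : Walk n m} → (∀ i → v zero < v (suc i)) → (∀ j → v zero < h j) →
          Merges π (v ∘ suc) h → Merges (south π) v h

Increasing : ∀ {n} → (Fin n → ℕ) → Set
Increasing f = ∀ {i j} → i Fin.< j → f i < f j

head-least : ∀ {n} {f : Fin (suc n) → ℕ} → Increasing f → ∀ i → f zero ≤ f i
head-least inc zero    = ≤-refl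
head-least inc (suc i) = <⇒≤ (inc z<s)

merge : ∀ m n (v : Fin m → ℕ) (h : Fin n → ℕ) → Increasing v → Increasing h →
        (∀ i j → v i ≢ h j) → Σ[ π ∈ Walk n m ] Merges π v h
merge zero zero v h v↑ h↑ v≢h = end , end
merge zero (suc n) v h v↑ h↑ v≢h
  with π , M ← merge zero n v (h ∘ suc) v↑ (h↑ ∘ s<s) (λ i j → v≢h i (suc j)) =
  west π , west (λ ()) (λ j → h↑ z<s) M
merge (suc m) zero v h v↑ h↑ v≢h
  with π , M ← merge m zero (v ∘ suc) h (v↑ ∘ s<s) h↑ (λ i j → v≢h (suc i) j) =
  south π , south (λ i → v↑ z<s) (λ ()) M
merge (suc m) (suc n) v h v↑ h↑ v≢h with <-cmp (v zero) (h zero)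
... | tri< v<h _ _
  with π , M ← merge m (suc n) (v ∘ suc) h (v↑ ∘ s<s) h↑ (λ i j → v≢h (suc i) j) =
  south π , south (λ i → v↑ z<s) (λ j → <-≤-trans v<h (head-least h↑ j)) M
... | tri≈ _ v≡h _ = contradiction v≡h (v≢h zero zero)
... | tri> _ _ h<v
  with π , M ← merge (suc m) n v (h ∘ suc) v↑ (h↑ ∘ s<s) (λ i j → v≢h i (suc j)) =
  west π , west (λ i → <-≤-trans h<v (head-least v↑ i)) (λ j → h↑ z<s) M

-- The entry consumed first has rank 0 and time 0. Removing it lowers both the rank and the time of
-- every other entry by one.
V-rank : ∀ {n m} {π : Walk n m} {v h} → Merges π v h → ∀ i → toℕ (Vᵗ π i) ≡ rank v h (v i)
V-rank {v = v} {h} (west {π = π} h<v _ M) i =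
  trans (V-west π i) (trans (cong suc (V-rank M i)) (sym (rank-tailʳ v h (h<v i))))
V-rank {v = v} {h} (south v<v v<h M) zero = sym (rank-least v h
  (λ { zero → ≤-refl ; (suc i) → <⇒≤ (v<v i) }) (λ j → <⇒≤ (v<h j)))
V-rank {v = v} {h} (south {π = π} v<v _ M) (suc i) =
  trans (V-south π i) (trans (cong suc (V-rank M i)) (sym (rank-tailˡ v h (v<v i))))

H-rank : ∀ {n m} {π : Walk n m} {v h} → Merges π v h → ∀ j → toℕ (Hᵗ π j) ≡ rank v h (h j)
H-rank {v = v} {h} (south {π = π} _ v<h M) j =
  trans (H-south π j) (trans (cong suc (H-rank M j)) (sym (rank-tailˡ v h (v<h j))))
H-rank {v = v} {h} (west {π = π} h<v h<h M) zero = trans (H-now π) (sym (rank-least v h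
  (λ i → <⇒≤ (h<v i)) (λ { zero → ≤-refl ; (suc j) → <⇒≤ (h<h j) })))
H-rank {v = v} {h} (west {π = π} _ h<h M) (suc j) =
  trans (H-west π j) (trans (cong suc (H-rank M j)) (sym (rank-tailʳ v h (h<h j))))

overlap⇒walk : ∀ {m n} (α : Partition m) (β : Partition n) (κ : Partition (m + n)) →
  IsOverlap α β κ → Σ[ π ∈ Walk n m ] (μ π ⊕ κ ↾ V π , ν′ π ⊕ κ ↾ H π) ≡ (α , β)
overlap⇒walk {m} {n} α β κ w@(σ , _) = π , cong₂ _,_
  (+ρ-injective λ i → trans (lookup-V κ π i)
    (trans (cong (lookup (κ +ρ)) (V≡σ i)) (overlapˡ α β κ w i)))
  (+ρ-injective λ j → trans (lookup-H κ π j)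
    (trans (cong (lookup (κ +ρ)) (H≡σ j)) (overlapʳ α β κ w j)))
  where
  v : Fin m → ℕ
  v i = toℕ (σ ⟨$⟩ʳ (i ↑ˡ n))

  h : Fin n → ℕ
  h j = toℕ (σ ⟨$⟩ʳ (m ↑ʳ j))

  merged : Σ[ π ∈ Walk n m ] Merges π v h
  merged = merge m n v h (overlapˡ-increasing α β κ w) (overlapʳ-increasing α β κ w)
    -- A common value would identify a left position with a right one.
    (λ i j e → <⇒≢ (↑ˡ<↑ʳ i j) (cong toℕ (⟨$⟩ʳ-injective σ (Fin.toℕ-injective e))))

  π = proj₁ merged

  -- Together `v` and `h` list all values of `σ`, so the rank counts the values below a given one
  -- and the step times of `π` are the values of `σ`.
  rank-σ : ∀ x → rank v h (toℕ (σ ⟨$⟩ʳ x)) ≡ toℕ (σ ⟨$⟩ʳ x)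
  rank-σ x = trans (sym (sum-splitAt m (λ y → 𝟙 (toℕ (σ ⟨$⟩ʳ y) <? toℕ (σ ⟨$⟩ʳ x)))))
                   (permutation-rank σ x)

  V≡σ : ∀ i → Vᵗ π i ≡ σ ⟨$⟩ʳ (i ↑ˡ n)
  V≡σ i = Fin.toℕ-injective (trans (V-rank (proj₂ merged) i) (rank-σ (i ↑ˡ n)))

  H≡σ : ∀ j → Hᵗ π j ≡ σ ⟨$⟩ʳ (m ↑ʳ j)
  H≡σ j = Fin.toℕ-injective (trans (H-rank (proj₂ merged) j) (rank-σ (m ↑ʳ j)))

-- The correspondence and its sign.

OverlapPairs-≡ : ∀ {m n κ} {p q : OverlapPairs m n κ} → proj₁ p ≡ proj₁ q → p ≡ q
OverlapPairs-≡ {p = p , e} {.p , e′} refl = cong (p ,_) (uip e e′)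

proposition4p3 : (m n : ℕ) (κ : Partition (m + n)) →
    (Σ[ Φ ∈ Walk n m ⤖ OverlapPairs m n κ ]
    (∀ π → proj₁ (Bijection.to Φ π) ≡ (μ π ⊕ κ ↾ V π , ν′ π ⊕ κ ↾ H π)))
    × (∀ (π : Walk n m) →
    (ε (μ π ⊕ κ ↾ V π) (ν′ π ⊕ κ ↾ H π) ≡ -1ℤ ^ ∣ ν π ∣)
    × (-1ℤ ^ ∣ ν π ∣ ≡ -1ℤ ^ (m * n ∸ ∣ μ π ∣)))
proposition4p3 m n κ =
  (mk⤖ {to = to} (injective , strictlySurjective⇒surjective surjective) , λ _ → refl) ,
  λ π →
    trans (overlap⇒ε (μ π ⊕ κ ↾ V π) (ν′ π ⊕ κ ↾ H π) κ (walk⇒overlap κ π))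
          (cong (-1ℤ ^_) (stepPermutation-inversions κ π)) ,
    cong (-1ℤ ^_) (∣ν∣-complement π)
  where
  to : Walk n m → OverlapPairs m n κ
  to π = (μ π ⊕ κ ↾ V π , ν′ π ⊕ κ ↾ H π) ,
         overlap⇒⋆ (μ π ⊕ κ ↾ V π) (ν′ π ⊕ κ ↾ H π) κ (walk⇒overlap κ π)

  injective : Injective _≡_ _≡_ to
  -- The first partition of the pair fixes the entries of `κ +ρ` at the south times; these entries
  -- being distinct, the times themselves agree.
  injective {π} {π′} e = V-injective π π′ λ i → +ρ-distinct κ _ _ (begin
    lookup (κ +ρ) (Vᵗ π i)
      ≡⟨ lookup-V κ π i ⟨
    lookup ((μ π ⊕ κ ↾ V π) +ρ) i
      ≡⟨ cong (λ p → lookup (proj₁ (proj₁ p) +ρ) i) e ⟩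
    lookup ((μ π′ ⊕ κ ↾ V π′) +ρ) i
      ≡⟨ lookup-V κ π′ i ⟩
    lookup (κ +ρ) (Vᵗ π′ i) ∎)

  surjective : ∀ y → ∃[ π ] to π ≡ y
  surjective ((α , β) , e) with overlap⇒walk α β κ (⋆⇒overlap α β e)
  ... | π , q = π , OverlapPairs-≡ q
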